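{- The sequence $(c_n)_{n\ge 0}$ satisfies, for all $n\ge 0$, $$\sum_{0\le k\le n}\frac{c_k}{n+1+k}=\frac{c_0}{n+1}+\ldots+\frac{c_n}{2n+1}=\delta_{n0},$$ where $\delta_{n0}=1$ if $n=0$ and $\delta_{n0}=0$ otherwise.
   Context: Let $\mathcal H=L^2([0,1],dx)$ (complex-valued functions, Lebesgue measure) with its norm $\|\cdot\|$. The sequence $(c_n)_{n\ge 0}$ is defined recursively: $c_0=1$, and, writing $p_n(x)=c_0+c_1x+\ldots+c_nx^n$, for each $n\ge 0$ the number $c_{n+1}$ is the unique complex number $c$ for which the norm $\|p_n(x)+c\,x^{n+1}\|$ is minimal among all $c\in\mathbb C$. (That is, $c_1,c_2,\ldots$ are the coefficients of the orthorecursive expansion of the function $1$ with respect to the system $x,x^2,x^3,\ldots$.) -}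

module Defs where

open import Algebra.Bundles using (RawRing)
import Algebra.Definitions.RawMonoid as RawMonoidDefs
import Algebra.Definitions.RawSemiring as RawSemiringDefs
open import Data.Bool using (if_then_else_)
open import Data.Fin using (Fin; zero; suc; inject₁; fromℕ; toℕ)
open import Data.Integer using (+_)
open import Data.Nat using (ℕ; suc; NonZero; _⊔_)
  renaming (_≤_ to _≤ℕ_)
import Data.Nat as ℕ
import Data.Nat.Properties as ℕₚ
open import Data.Product using (∃; ∃₂; _×_; _,_)
open import Data.Rational
  using (ℚ; 0ℚ; 1ℚ; ½; _+_; _*_; _-_; -_; _<_; _≤_; ∣_∣; _/_; 1/_; Positive; positive)
import Data.Rational as ℚ
import Data.Rational.Properties as ℚₚ
open import Data.Rational.Solver using (module +-*-Solver)
open import Data.Vec.Functional using (Vector)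
open import Level using (0ℓ)
open import Relation.Binary.PropositionalEquality
  using (_≡_; refl; sym; trans; cong; cong₂; subst)
open import Relation.Nullary using (does)

-- The real numbers, as Cauchy sequences of rationals with a modulus.

IsCauchy : (ℕ → ℚ) → Set
IsCauchy s = ∀ ε → 0ℚ < ε → ∃ λ N → ∀ m n → N ≤ℕ m → N ≤ℕ n → ∣ s m - s n ∣ < ε

record ℝ : Set where
  constructor mkℝ
  field
    seq    : ℕ → ℚ
    cauchy : IsCauchy seq

open ℝ public

infix 4 _≈ℝ_ _≤ℝ_

_≈ℝ_ : ℝ → ℝ → Set
x ≈ℝ y = ∀ ε → 0ℚ < ε → ∃ λ N → ∀ n → N ≤ℕ n → ∣ seq x n - seq y n ∣ < ε

_≤ℝ_ : ℝ → ℝ → Set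
x ≤ℝ y = ∀ ε → 0ℚ < ε → ∃ λ N → ∀ n → N ≤ℕ n → seq x n < seq y n + ε

fromℚ : ℚ → ℝ
fromℚ q = mkℝ (λ _ → q) λ ε 0<ε →
  0 , λ _ _ _ _ → subst (_< ε) (sym (cong ∣_∣ (ℚₚ.+-inverseʳ q))) 0<ε

0ℝ 1ℝ : ℝ
0ℝ = fromℚ 0ℚ
1ℝ = fromℚ 1ℚ

open +-*-Solver

private abstract
  halves : ∀ ε → ½ * ε + ½ * ε ≡ ε
  halves ε = trans (sym (ℚₚ.*-distribʳ-+ ε ½ ½)) (ℚₚ.*-identityˡ ε)

  0<p*q : ∀ {p q} → 0ℚ < p → 0ℚ < q → 0ℚ < p * q
  0<p*q {p} {q} 0<p 0<q = subst (_< p * q) (ℚₚ.*-zeroʳ p)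
    (ℚₚ.*-monoʳ-<-pos p {{positive 0<p}} 0<q)

  0<½* : ∀ {ε} → 0ℚ < ε → 0ℚ < ½ * ε
  0<½* = 0<p*q (ℚₚ.positive⁻¹ ½)

  +-cauchy : ∀ {s t} → IsCauchy s → IsCauchy t → IsCauchy (λ n → s n + t n)
  +-cauchy {s} {t} cs ct ε 0<ε with cs (½ * ε) (0<½* 0<ε) | ct (½ * ε) (0<½* 0<ε)
  ... | M , p | N , q = M ⊔ N , λ m n m≥ n≥ → begin-strict
    ∣ (s m + t m) - (s n + t n) ∣
      ≡⟨ cong ∣_∣ (solve 4 (λ a b c d → (a :+ b) :- (c :+ d) := (a :- c) :+ (b :- d))
           refl (s m) (t m) (s n) (t n)) ⟩
    ∣ (s m - s n) + (t m - t n) ∣   ≤⟨ ℚₚ.∣p+q∣≤∣p∣+∣q∣ (s m - s n) (t m - t n) ⟩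
    ∣ s m - s n ∣ + ∣ t m - t n ∣
      <⟨ ℚₚ.+-mono-< (p m n (ℕₚ.m⊔n≤o⇒m≤o M N m≥) (ℕₚ.m⊔n≤o⇒m≤o M N n≥))
                     (q m n (ℕₚ.m⊔n≤o⇒n≤o M N m≥) (ℕₚ.m⊔n≤o⇒n≤o M N n≥)) ⟩
    ½ * ε + ½ * ε                   ≡⟨ halves ε ⟩
    ε ∎
    where open ℚₚ.≤-Reasoning

  neg-cauchy : ∀ {s} → IsCauchy s → IsCauchy (λ n → - s n)
  neg-cauchy {s} cs ε 0<ε with cs ε 0<ε
  ... | N , p = N , λ m n m≥ n≥ → subst (_< ε)
    (cong ∣_∣ (solve 2 (λ a b → b :- a := (:- a) :- (:- b)) refl (s m) (s n)))
    (p n m n≥ m≥)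

  eventuallyBounded : ∀ {s} → IsCauchy s →
    ∃₂ λ B N → 0ℚ < B × (∀ n → N ≤ℕ n → ∣ s n ∣ ≤ B)
  eventuallyBounded {s} cs with cs 1ℚ (ℚₚ.positive⁻¹ 1ℚ)
  ... | N , p = 1ℚ + ∣ s N ∣ , N
    , ℚₚ.+-mono-<-≤ (ℚₚ.positive⁻¹ 1ℚ) (ℚₚ.0≤∣p∣ (s N))
    , λ n n≥ → begin
        ∣ s n ∣
          ≡⟨ cong ∣_∣ (solve 2 (λ a b → a := (a :- b) :+ b) refl (s n) (s N)) ⟩
        ∣ (s n - s N) + s N ∣     ≤⟨ ℚₚ.∣p+q∣≤∣p∣+∣q∣ (s n - s N) (s N) ⟩
        ∣ s n - s N ∣ + ∣ s N ∣   ≤⟨ ℚₚ.+-monoˡ-≤ ∣ s N ∣ (ℚₚ.<⇒≤ (p n N n≥ ℕₚ.≤-refl)) ⟩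
        1ℚ + ∣ s N ∣ ∎
    where open ℚₚ.≤-Reasoning

  ∣*∣-bound : ∀ {b d B δ} → 0ℚ < B → ∣ b ∣ ≤ B → ∣ d ∣ < δ → ∣ b * d ∣ < B * δ
  ∣*∣-bound {b} {d} {B} {δ} 0<B b≤B d<δ = begin-strict
    ∣ b * d ∣       ≡⟨ ℚₚ.∣p*q∣≡∣p∣*∣q∣ b d ⟩
    ∣ b ∣ * ∣ d ∣   ≤⟨ ℚₚ.*-monoʳ-≤-nonNeg ∣ d ∣ {{ℚₚ.∣-∣-nonNeg d}} b≤B ⟩
    B * ∣ d ∣       <⟨ ℚₚ.*-monoʳ-<-pos B {{positive 0<B}} d<δ ⟩
    B * δ ∎
    where open ℚₚ.≤-Reasoning

  scale : ∀ {B ε} → 0ℚ < B → 0ℚ < ε → ∃ λ δ → 0ℚ < δ × B * δ ≡ ½ * ε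
  scale {B} {ε} 0<B 0<ε =
    1/ B * (½ * ε)
    , 0<p*q (ℚₚ.positive⁻¹ (1/ B) {{ℚₚ.1/pos⇒pos B}}) (0<½* 0<ε)
    , trans (sym (ℚₚ.*-assoc B (1/ B) (½ * ε)))
        (trans (cong (_* (½ * ε)) (ℚₚ.*-inverseʳ B)) (ℚₚ.*-identityˡ (½ * ε)))
    where instance
      B-pos : Positive B
      B-pos = positive 0<B
      B-nonZero : ℚ.NonZero B
      B-nonZero = ℚₚ.pos⇒nonZero B

  *-split : ∀ a b c d → a * b - c * d ≡ a * (b - d) + d * (a - c)
  *-split = solve 4 (λ a b c d → a :* b :- c :* d := a :* (b :- d) :+ d :* (a :- c)) refl

  *-diff-bound : ∀ {A B α β ε} a b c d → 0ℚ < A → 0ℚ < B →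
    A * α ≡ ½ * ε → B * β ≡ ½ * ε →
    ∣ a ∣ ≤ A → ∣ d ∣ ≤ B → ∣ b - d ∣ < α → ∣ a - c ∣ < β →
    ∣ a * b - c * d ∣ < ε
  *-diff-bound {A} {B} {α} {β} {ε} a b c d 0<A 0<B Aα Bβ a≤A d≤B b-d<α a-c<β = begin-strict
    ∣ a * b - c * d ∣                     ≡⟨ cong ∣_∣ (*-split a b c d) ⟩
    ∣ a * (b - d) + d * (a - c) ∣         ≤⟨ ℚₚ.∣p+q∣≤∣p∣+∣q∣ (a * (b - d)) (d * (a - c)) ⟩
    ∣ a * (b - d) ∣ + ∣ d * (a - c) ∣
      <⟨ ℚₚ.+-mono-< (∣*∣-bound {a} {b - d} 0<A a≤A b-d<α) (∣*∣-bound {d} {a - c} 0<B d≤B a-c<β) ⟩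
    A * α + B * β                         ≡⟨ cong₂ _+_ Aα Bβ ⟩
    ½ * ε + ½ * ε                         ≡⟨ halves ε ⟩
    ε ∎
    where open ℚₚ.≤-Reasoning

  *-cauchy : ∀ {s t} → IsCauchy s → IsCauchy t → IsCauchy (λ n → s n * t n)
  *-cauchy {s} {t} cs ct ε 0<ε =
    let A , M₁ , 0<A , s≤A = eventuallyBounded {s} cs
        B , N₁ , 0<B , t≤B = eventuallyBounded {t} ct
        α , 0<α , Aα = scale 0<A 0<ε
        β , 0<β , Bβ = scale 0<B 0<ε
        M₂ , p = ct α 0<α
        N₂ , q = cs β 0<β
    in (M₁ ⊔ N₁) ⊔ (M₂ ⊔ N₂) , λ m n m≥ n≥ →
    let m≥₁ = ℕₚ.m⊔n≤o⇒m≤o (M₁ ⊔ N₁) (M₂ ⊔ N₂) m≥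
        m≥₂ = ℕₚ.m⊔n≤o⇒n≤o (M₁ ⊔ N₁) (M₂ ⊔ N₂) m≥
        n≥₁ = ℕₚ.m⊔n≤o⇒m≤o (M₁ ⊔ N₁) (M₂ ⊔ N₂) n≥
        n≥₂ = ℕₚ.m⊔n≤o⇒n≤o (M₁ ⊔ N₁) (M₂ ⊔ N₂) n≥
    in *-diff-bound (s m) (t m) (s n) (t n) 0<A 0<B Aα Bβ
         (s≤A m (ℕₚ.m⊔n≤o⇒m≤o M₁ N₁ m≥₁))
         (t≤B n (ℕₚ.m⊔n≤o⇒n≤o M₁ N₁ n≥₁))
         (p m n (ℕₚ.m⊔n≤o⇒m≤o M₂ N₂ m≥₂) (ℕₚ.m⊔n≤o⇒m≤o M₂ N₂ n≥₂))
         (q m n (ℕₚ.m⊔n≤o⇒n≤o M₂ N₂ m≥₂) (ℕₚ.m⊔n≤o⇒n≤o M₂ N₂ n≥₂))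

infixl 6 _+ℝ_ _-ℝ_
infixl 7 _*ℝ_
infix  8 -ℝ_

_+ℝ_ _*ℝ_ : ℝ → ℝ → ℝ
x +ℝ y = mkℝ (λ n → seq x n + seq y n) (+-cauchy {seq x} {seq y} (cauchy x) (cauchy y))
x *ℝ y = mkℝ (λ n → seq x n * seq y n) (*-cauchy {seq x} {seq y} (cauchy x) (cauchy y))

-ℝ_ : ℝ → ℝ
-ℝ x = mkℝ (λ n → - seq x n) (neg-cauchy {seq x} (cauchy x))

_-ℝ_ : ℝ → ℝ → ℝ
x -ℝ y = x +ℝ (-ℝ y)

ℝ-rawRing : RawRing 0ℓ 0ℓ
ℝ-rawRing = record
  { Carrier = ℝ ; _≈_ = _≈ℝ_ ; _+_ = _+ℝ_ ; _*_ = _*ℝ_ ; -_ = -ℝ_ ; 0# = 0ℝ ; 1# = 1ℝ }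

open RawMonoidDefs (RawRing.+-rawMonoid ℝ-rawRing) public
  using () renaming (sum to sumℝ)

record ℂ : Set where
  constructor _+i_
  field
    re im : ℝ

open ℂ public

infix  4 _≈ℂ_
infixl 6 _+ℂ_
infixl 7 _*ℂ_
infix  8 -ℂ_

_≈ℂ_ : ℂ → ℂ → Set
z ≈ℂ w = re z ≈ℝ re w × im z ≈ℝ im w

_+ℂ_ _*ℂ_ : ℂ → ℂ → ℂ
z +ℂ w = (re z +ℝ re w) +i (im z +ℝ im w)
z *ℂ w = (re z *ℝ re w -ℝ im z *ℝ im w) +i (re z *ℝ im w +ℝ im z *ℝ re w)

-ℂ_ : ℂ → ℂ
-ℂ z = (-ℝ re z) +i (-ℝ im z)

fromℝ : ℝ → ℂ
fromℝ x = x +i 0ℝ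

0ℂ 1ℂ : ℂ
0ℂ = fromℝ 0ℝ
1ℂ = fromℝ 1ℝ

∣_∣² : ℂ → ℝ
∣ z ∣² = re z *ℝ re z +ℝ im z *ℝ im z

ℂ-rawRing : RawRing 0ℓ 0ℓ
ℂ-rawRing = record
  { Carrier = ℂ ; _≈_ = _≈ℂ_ ; _+_ = _+ℂ_ ; _*_ = _*ℂ_ ; -_ = -ℂ_ ; 0# = 0ℂ ; 1# = 1ℂ }

open RawSemiringDefs (RawRing.rawSemiring ℂ-rawRing) public
  using () renaming (sum to sumℂ; _^_ to _^ℂ_)

infixl 7 _/ℕ_

_/ℕ_ : ℂ → (m : ℕ) .{{_ : NonZero m}} → ℂ
z /ℕ m = z *ℂ fromℝ (fromℚ (+ 1 / m))

-- ∑≤ n f = f 0 + … + f n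
∑≤ : ℕ → (ℕ → ℂ) → ℂ
∑≤ n f = sumℂ {suc n} (λ k → f (toℕ k))

δ : ℕ → ℕ → ℂ
δ m n = if does (m ℕ.≟ n) then 1ℂ else 0ℂ

-- The Riemann integral over [0,1].  On continuous functions it agrees with
-- the Lebesgue integral, and the norm below with that of L²([0,1],dx).

record TaggedPartition : Set where
  field
    size  : ℕ
    point : Vector ℝ (suc size)
    tag   : Vector ℝ size
    first : point zero ≈ℝ 0ℝ
    last  : point (fromℕ size) ≈ℝ 1ℝ
    lower : ∀ i → point (inject₁ i) ≤ℝ tag i
    upper : ∀ i → tag i ≤ℝ point (suc i)

  width : Vector ℝ size
  width i = point (suc i) -ℝ point (inject₁ i)

  riemannSum : (ℝ → ℝ) → ℝ
  riemannSum f = sumℝ (λ i → f (tag i) *ℝ width i)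

open TaggedPartition using (width; riemannSum)

IsIntegral : (ℝ → ℝ) → ℝ → Set
IsIntegral f I = ∀ ε → 0ℚ < ε → ∃ λ η → 0ℚ < η ×
  (∀ P → (∀ i → width P i ≤ℝ fromℚ η) →
    riemannSum P f ≤ℝ I +ℝ fromℚ ε × I ≤ℝ riemannSum P f +ℝ fromℚ ε)

IsNorm : (ℝ → ℂ) → ℝ → Set
IsNorm f r = 0ℝ ≤ℝ r × IsIntegral (λ x → ∣ f x ∣²) (r *ℝ r)

-- The norm is a partial function, so the comparison asserts that both sides exist.
‖_‖≤‖_‖ : (ℝ → ℂ) → (ℝ → ℂ) → Set
‖ f ‖≤‖ g ‖ = ∃₂ λ r s → IsNorm f r × IsNorm g s × r ≤ℝ s

partialSum : (ℕ → ℂ) → ℕ → ℝ → ℂ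
partialSum c n x = ∑≤ n λ k → c k *ℂ fromℝ x ^ℂ k

IsMinimizer : (ℕ → ℂ) → ℕ → ℂ → Set
IsMinimizer c n a = ∀ b → ‖ extend a ‖≤‖ extend b ‖
  where
  extend : ℂ → ℝ → ℂ
  extend d x = partialSum c n x +ℂ d *ℂ fromℝ x ^ℂ suc n

IsOrthorecursive : (ℕ → ℂ) → Set
IsOrthorecursive c =
  c 0 ≈ℂ 1ℂ ×
  (∀ n → IsMinimizer c n (c (suc n)) × (∀ a → IsMinimizer c n a → a ≈ℂ c (suc n)))

{-# OPTIONS --safe #-}

-- Write m = n + 1, let w = ∑_{k≤m} c_k / (m + k + 1) = ⟨p_m , x^m⟩, and compare the minimizer
-- c_m with c_m − w.  This changes the squared norm by −2|w|² + |w|² ‖x^m‖² ≤ −|w|², so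
-- minimality forces w = 0.  The norms are only given as Riemann integrals, so the comparison
-- is made on Riemann sums over the uniform partitions, where those of x^j differ from
-- 1/(j+1) by at most the mesh.  All operations on reals act index by index on the
-- approximating sequences, which reduces every estimate to one between rationals.
module Submission where

open import Defs
open import Algebra.Bundles using (CommutativeRing)
import Algebra.Properties.Semiring.Exp as Exp
import Algebra.Properties.Semiring.Sum as Sum
open import Data.Fin using (Fin; toℕ; fromℕ)
open import Data.Fin.Properties using (toℕ-inject₁; toℕ-fromℕ)
import Data.Integer as ℤ
import Data.Integer.Properties as ℤₚ
open import Data.Nat using (ℕ; zero; suc; _+_; _⊔_; z≤n; s≤s)
  renaming (_≤_ to _≤ℕ_)
import Data.Nat.Properties as ℕₚ
open import Data.Product using (∃; _×_; _,_; proj₁; proj₂)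
open import Data.Rational
  using (ℚ; mkℚ; 0ℚ; 1ℚ; _-_; -_; _*_; _<_; _≤_; ∣_∣; _/_; 1/_; _⊓_; toℚᵘ;
         NonZero; nonNegative; positive)
  renaming (_+_ to _⊕_)
import Data.Rational.Properties as ℚₚ
open import Data.Rational.Solver using (module +-*-Solver)
import Data.Rational.Unnormalised as ℚᵘ
import Data.Rational.Unnormalised.Properties as ℚᵘₚ
open import Data.Sum using (inj₁; inj₂)
open import Data.Vec.Functional using (Vector)
open import Function using (_∘_)
open import Relation.Binary.PropositionalEquality
  using (_≡_; refl; sym; trans; cong; cong₂; subst; subst₂; module ≡-Reasoning)
open import Relation.Nullary using (contradiction)

open CommutativeRing ℚₚ.+-*-commutativeRing using (semiring)
open Exp semiring using (_^_; ^-homo-*)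
open Sum semiring using (sum; sum-cong-≗; ∑-comm; *-distribˡ-sum; *-distribʳ-sum)
open +-*-Solver using (solve; con; _:=_; _:+_; _:*_; _:-_; :-_)

-- Rational arithmetic

0≤-+ : ∀ {p q} → 0ℚ ≤ p → 0ℚ ≤ q → 0ℚ ≤ p ⊕ q
0≤-+ = ℚₚ.+-mono-≤ {0ℚ} {_} {0ℚ}

*-monoˡ-≤ : ∀ {r p q} → 0ℚ ≤ r → p ≤ q → r * p ≤ r * q
*-monoˡ-≤ {r} 0≤r = ℚₚ.*-monoˡ-≤-nonNeg r {{nonNegative 0≤r}}

*-monoʳ-≤ : ∀ {r p q} → 0ℚ ≤ r → p ≤ q → p * r ≤ q * r
*-monoʳ-≤ {r} 0≤r = ℚₚ.*-monoʳ-≤-nonNeg r {{nonNegative 0≤r}}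

0≤-* : ∀ {p q} → 0ℚ ≤ p → 0ℚ ≤ q → 0ℚ ≤ p * q
0≤-* {p} {q} 0≤p 0≤q = subst (_≤ p * q) (ℚₚ.*-zeroʳ p) (*-monoˡ-≤ 0≤p 0≤q)

0<-* : ∀ {p q} → 0ℚ < p → 0ℚ < q → 0ℚ < p * q
0<-* {p} {q} 0<p 0<q =
  subst (_< p * q) (ℚₚ.*-zeroʳ p) (ℚₚ.*-monoʳ-<-pos p {{positive 0<p}} 0<q)

p≤q⇒0≤q-p : ∀ {p q} → p ≤ q → 0ℚ ≤ q - p
p≤q⇒0≤q-p {p} {q} p≤q = subst (_≤ q - p) (ℚₚ.+-inverseʳ p) (ℚₚ.+-monoˡ-≤ (- p) p≤q)

p<q⇒0<q-p : ∀ {p q} → p < q → 0ℚ < q - p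
p<q⇒0<q-p {p} {q} p<q = subst (_< q - p) (ℚₚ.+-inverseʳ p) (ℚₚ.+-monoˡ-< (- p) p<q)

0≤d⇒p≤p+d : ∀ {p q d} → 0ℚ ≤ d → p ⊕ d ≡ q → p ≤ q
0≤d⇒p≤p+d {p} 0≤d eq = subst₂ _≤_ (ℚₚ.+-identityʳ p) eq (ℚₚ.+-monoʳ-≤ p 0≤d)

0<d⇒p<p+d : ∀ {p q d} → 0ℚ < d → p ⊕ d ≡ q → p < q
0<d⇒p<p+d {p} 0<d eq = subst₂ _<_ (ℚₚ.+-identityʳ p) eq (ℚₚ.+-monoʳ-< p 0<d)

∣p∣²≡p² : ∀ p → ∣ p ∣ * ∣ p ∣ ≡ p * p
∣p∣²≡p² p with ℚₚ.∣p∣≡p∨∣p∣≡-p p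
... | inj₁ eq rewrite eq = refl
... | inj₂ eq rewrite eq = solve 1 (λ a → (:- a) :* (:- a) := a :* a) refl p

0≤p² : ∀ p → 0ℚ ≤ p * p
0≤p² p = subst (0ℚ ≤_) (∣p∣²≡p² p) (0≤-* (ℚₚ.0≤∣p∣ p) (ℚₚ.0≤∣p∣ p))

p≤∣p∣ : ∀ p → p ≤ ∣ p ∣
p≤∣p∣ p with ℚₚ.≤-total 0ℚ p
... | inj₁ 0≤p = ℚₚ.≤-reflexive (sym (ℚₚ.0≤p⇒∣p∣≡p 0≤p))
... | inj₂ p≤0 = ℚₚ.≤-trans p≤0 (ℚₚ.0≤∣p∣ p)

-p≤∣p∣ : ∀ p → - p ≤ ∣ p ∣
-p≤∣p∣ p = subst (- p ≤_) (ℚₚ.∣-p∣≡∣p∣ p) (p≤∣p∣ (- p))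

p²<q²⇒∣p∣<q : ∀ {p q} → 0ℚ < q → p * p < q * q → ∣ p ∣ < q
p²<q²⇒∣p∣<q {p} {q} 0<q p²<q² = ℚₚ.≰⇒> λ q≤∣p∣ → ℚₚ.<-irrefl refl (begin-strict
  q * q          ≤⟨ *-monoˡ-≤ (ℚₚ.<⇒≤ 0<q) q≤∣p∣ ⟩
  q * ∣ p ∣      ≤⟨ *-monoʳ-≤ (ℚₚ.0≤∣p∣ p) q≤∣p∣ ⟩
  ∣ p ∣ * ∣ p ∣  ≡⟨ ∣p∣²≡p² p ⟩
  p * p          <⟨ p²<q² ⟩
  q * q          ∎)
  where open ℚₚ.≤-Reasoning

0<p⊓q : ∀ {p q} → 0ℚ < p → 0ℚ < q → 0ℚ < p ⊓ q
0<p⊓q {p} {q} 0<p 0<q with ℚₚ.≤-total p q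
... | inj₁ p≤q = subst (0ℚ <_) (sym (ℚₚ.p≤q⇒p⊓q≡p p≤q)) 0<p
... | inj₂ q≤p = subst (0ℚ <_) (sym (ℚₚ.p≥q⇒p⊓q≡q q≤p)) 0<q

-- The witness `ε / (B + ε)` meets both upper bounds at once, and its denominator is positive even
-- when `B` is zero.
smallMultiple : ∀ {B ε} → 0ℚ ≤ B → 0ℚ < ε → ∃ λ η → 0ℚ < η × η ≤ 1ℚ × B * η ≤ ε
smallMultiple {B} {ε} 0≤B 0<ε = η , 0<η , bound 1ℚ ε≤D , bound′
  where
  D = B ⊕ ε
  0<D : 0ℚ < D
  0<D = ℚₚ.+-mono-≤-< {0ℚ} {B} {0ℚ} 0≤B 0<ε
  ε≤D : ε ≤ 1ℚ * D
  ε≤D = 0≤d⇒p≤p+d 0≤B (solve 2 (λ b e → e :+ b := con 1ℚ :* (b :+ e)) refl B ε)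
  instance
    D≢0 : NonZero D
    D≢0 = ℚₚ.pos⇒nonZero D {{positive 0<D}}
  1/D = 1/ D
  0<1/D : 0ℚ < 1/D
  0<1/D = ℚₚ.positive⁻¹ 1/D {{ℚₚ.1/pos⇒pos D {{positive 0<D}}}}
  η = ε * 1/D
  0<η = 0<-* 0<ε 0<1/D
  bound : ∀ p → ε ≤ p * D → η ≤ p
  bound p ε≤pD = subst (η ≤_)
    (trans (ℚₚ.*-assoc p D 1/D) (trans (cong (p *_) (ℚₚ.*-inverseʳ D)) (ℚₚ.*-identityʳ p)))
    (*-monoʳ-≤ (ℚₚ.<⇒≤ 0<1/D) ε≤pD)
  bound′ : B * η ≤ ε
  bound′ = 0≤d⇒p≤p+d (0≤-* (ℚₚ.<⇒≤ 0<ε) (ℚₚ.<⇒≤ 0<η)) (begin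
    B * (ε * 1/D) ⊕ ε * (ε * 1/D)
      ≡⟨ solve 3 (λ b e d → b :* (e :* d) :+ e :* (e :* d) := e :* ((b :+ e) :* d)) refl B ε 1/D ⟩
    ε * (D * 1/D)  ≡⟨ cong (ε *_) (ℚₚ.*-inverseʳ D) ⟩
    ε * 1ℚ         ≡⟨ ℚₚ.*-identityʳ ε ⟩
    ε              ∎)
    where open ≡-Reasoning

2ℚ 3ℚ 4ℚ : ℚ
2ℚ = ℤ.+ 2 / 1
3ℚ = ℤ.+ 3 / 1
4ℚ = ℤ.+ 4 / 1

-- Since 0 < r + η < s + 2η, the difference (s + 2η)² - (r + η)² is positive. It equals s² - r² +
-- η(4s - 2r + 3η), and the last term is at most (4C + 2B + 3)η, which is at most ε.
square-mono-approx : ∀ {B C ε η} r s → 0ℚ < η → η ≤ 1ℚ → (4ℚ * C ⊕ 2ℚ * B ⊕ 3ℚ) * η ≤ ε →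
  ∣ r ∣ ≤ B → ∣ s ∣ ≤ C → 0ℚ < r ⊕ η → r < s ⊕ η → r * r < s * s ⊕ ε
square-mono-approx {B} {C} {ε} {η} r s 0<η η≤1 Kη≤ε ∣r∣≤B ∣s∣≤C 0<r+η r<s+η = 0<d⇒p<p+d
  (ℚₚ.+-mono-<-≤ {0ℚ} {_} {0ℚ}
    (0<-* 0<d (ℚₚ.+-mono-< {0ℚ} {_} {0ℚ} (ℚₚ.+-mono-< {0ℚ} {_} {0ℚ} 0<d 0<r+η) 0<r+η))
    (0≤-+ (p≤q⇒0≤q-p Kη≤ε) (0≤-* (ℚₚ.<⇒≤ 0<η)
      (0≤-+ (0≤-+ (0≤-* (ℚₚ.nonNegative⁻¹ 4ℚ) (p≤q⇒0≤q-p (ℚₚ.≤-trans (p≤∣p∣ s) ∣s∣≤C)))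
                  (0≤-* (ℚₚ.nonNegative⁻¹ 2ℚ) (p≤q⇒0≤q-p (ℚₚ.≤-trans (-p≤∣p∣ r) ∣r∣≤B))))
            (0≤-* (ℚₚ.nonNegative⁻¹ 3ℚ) (p≤q⇒0≤q-p η≤1))))))
  (solve 6 (λ r s η B C ε →
      r :* r :+ ((s :+ η :- r) :* (s :+ η :- r :+ (r :+ η) :+ (r :+ η))
        :+ (ε :- (con 4ℚ :* C :+ con 2ℚ :* B :+ con 3ℚ) :* η
          :+ η :* (con 4ℚ :* (C :- s) :+ con 2ℚ :* (B :- (:- r)) :+ con 3ℚ :* (con 1ℚ :- η))))
      := s :* s :+ ε) refl r s η B C ε)
  where 0<d = p<q⇒0<q-p r<s+η

-- Unit fractions and the Archimedean property

unitFraction : ℕ → ℚ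
unitFraction n = ℤ.+ 1 / suc n

0<unitFraction : ∀ n → 0ℚ < unitFraction n
0<unitFraction n = ℚₚ.positive⁻¹ _ {{ℚₚ.normalize-pos 1 (suc n)}}

-- A positive fraction has numerator at least 1, so the unit fraction with the same denominator lies
-- below it. The field `d` stores the denominator minus one, which is also how `unitFraction` is
-- indexed.
archimedean : ∀ {η} → 0ℚ < η → ∃ λ N → unitFraction N ≤ η
archimedean {mkℚ (ℤ.+ zero) d c} 0<η = contradiction (positive 0<η) λ ()
archimedean {mkℚ (ℤ.+ suc n) d c} 0<η = d , ℚₚ.toℚᵘ-cancel-≤
  (ℚᵘₚ.≤-trans (ℚᵘₚ.≤-reflexive (ℚₚ.toℚᵘ-fromℚᵘ (ℚᵘ.mkℚᵘ (ℤ.+ 1) d)))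
    (ℚᵘ.*≤* (ℤₚ.*-monoʳ-≤-nonNeg (ℤ.+ suc d) {ℤ.+ 1} {ℤ.+ suc n} (ℤ.+≤+ (s≤s z≤n)))))
archimedean {mkℚ (ℤ.-[1+ n ]) d c} 0<η = contradiction (positive 0<η) λ ()

fineMesh : ∀ {D η ε} → 0ℚ ≤ D → 0ℚ < η → 0ℚ < ε → ∃ λ N → unitFraction N ≤ η × D * unitFraction N ≤ ε
fineMesh {D} {η} 0≤D 0<η 0<ε =
  let θ , 0<θ , _ , Dθ≤ε = smallMultiple 0≤D 0<ε
      N , h≤ = archimedean (0<p⊓q 0<η 0<θ)
  in N , ℚₚ.≤-trans h≤ (ℚₚ.p⊓q≤p η θ)
       , ℚₚ.≤-trans (*-monoˡ-≤ 0≤D (ℚₚ.≤-trans h≤ (ℚₚ.p⊓q≤q η θ))) Dθ≤ε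

-- The embedding of the naturals, by recursion: `ι (suc n)` unfolds to `1ℚ ⊕ ι n`, which ring
-- identities and inductions on exponents can use directly.
ι : ℕ → ℚ
ι zero    = 0ℚ
ι (suc n) = 1ℚ ⊕ ι n

0≤ι : ∀ n → 0ℚ ≤ ι n
0≤ι zero    = ℚₚ.≤-refl
0≤ι (suc n) = 0≤-+ (ℚₚ.<⇒≤ (ℚₚ.positive⁻¹ 1ℚ)) (0≤ι n)

0<ι-suc : ∀ n → 0ℚ < ι (suc n)
0<ι-suc n = ℚₚ.+-mono-<-≤ {0ℚ} {1ℚ} {0ℚ} (ℚₚ.positive⁻¹ 1ℚ) (0≤ι n)

-- Fractions in `ℚ` are normalised by a gcd, so the inductive step is checked on unnormalised
-- rationals, where it is an integer identity after cross-multiplication.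
ι*unitFraction : ∀ k n → ι k * unitFraction n ≡ ℤ.+ k / suc n
ι*unitFraction zero    n = trans (ℚₚ.*-zeroˡ (unitFraction n)) (sym (ℚₚ.0/n≡0 (suc n)))
ι*unitFraction (suc k) n = begin
  (1ℚ ⊕ ι k) * u        ≡⟨ solve 2 (λ a b → (con 1ℚ :+ a) :* b := b :+ a :* b) refl (ι k) u ⟩
  u ⊕ ι k * u           ≡⟨ cong (u ⊕_) (ι*unitFraction k n) ⟩
  u ⊕ ℤ.+ k / suc n     ≡⟨ ℚₚ.toℚᵘ-injective add ⟩
  ℤ.+ suc k / suc n     ∎
  where
  open ≡-Reasoning
  u = unitFraction n
  add : toℚᵘ (u ⊕ ℤ.+ k / suc n) ℚᵘ.≃ toℚᵘ (ℤ.+ suc k / suc n)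
  add = ℚᵘₚ.≃-trans (ℚₚ.toℚᵘ-homo-+ u (ℤ.+ k / suc n))
    (ℚᵘₚ.≃-trans (ℚᵘₚ.+-cong (ℚₚ.toℚᵘ-fromℚᵘ (ℚᵘ.mkℚᵘ (ℤ.+ 1) n)) (ℚₚ.toℚᵘ-fromℚᵘ (ℚᵘ.mkℚᵘ (ℤ.+ k) n)))
    (ℚᵘₚ.≃-trans (ℚᵘ.*≡* (begin
        (ℤ.+ 1 ℤ.* d ℤ.+ ℤ.+ k ℤ.* d) ℤ.* d  ≡⟨ cong (ℤ._* d) (sym (ℤₚ.*-distribʳ-+ d (ℤ.+ 1) (ℤ.+ k))) ⟩
        (ℤ.+ suc k ℤ.* d) ℤ.* d              ≡⟨ ℤₚ.*-assoc (ℤ.+ suc k) d d ⟩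
        ℤ.+ suc k ℤ.* (d ℤ.* d)              ∎))
      (ℚᵘₚ.≃-sym (ℚₚ.toℚᵘ-fromℚᵘ (ℚᵘ.mkℚᵘ (ℤ.+ suc k) n)))))
    where d = ℤ.+ suc n

ι-suc*unitFraction : ∀ n → ι (suc n) * unitFraction n ≡ 1ℚ
ι-suc*unitFraction n = trans (ι*unitFraction (suc n) n)
  (ℚₚ.fromℚᵘ-cong {ℚᵘ.mkℚᵘ (ℤ.+ suc n) n} {ℚᵘ.mkℚᵘ (ℤ.+ 1) 0} (ℚᵘ.*≡* (ℤₚ.*-comm (ℤ.+ suc n) (ℤ.+ 1))))

-- Powers and a mean value inequality for them

0≤^ : ∀ {x} → 0ℚ ≤ x → ∀ n → 0ℚ ≤ x ^ n
0≤^ 0≤x zero    = ℚₚ.<⇒≤ (ℚₚ.positive⁻¹ 1ℚ)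
0≤^ 0≤x (suc n) = 0≤-* 0≤x (0≤^ 0≤x n)

^-mono-≤ : ∀ {x y} → 0ℚ ≤ x → x ≤ y → ∀ n → x ^ n ≤ y ^ n
^-mono-≤ 0≤x x≤y zero    = ℚₚ.≤-refl
^-mono-≤ 0≤x x≤y (suc n) = ℚₚ.≤-trans (*-monoʳ-≤ (0≤^ 0≤x n) x≤y)
  (*-monoˡ-≤ (ℚₚ.≤-trans 0≤x x≤y) (^-mono-≤ 0≤x x≤y n))

1^n≡1 : ∀ n → 1ℚ ^ n ≡ 1ℚ
1^n≡1 zero    = refl
1^n≡1 (suc n) = trans (ℚₚ.*-identityˡ _) (1^n≡1 n)

-- Lower half of the mean value estimate for the power n + 1, stated without division or
-- derivatives. The induction rests on y^(n+2) - x^(n+2) = x (y^(n+1) - x^(n+1)) + y^(n+1) (y - x),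
-- with y^(n+1) bounded below by x^(n+1) in the last term.
^-suc-increment-lower : ∀ {x y} → 0ℚ ≤ x → x ≤ y → ∀ n →
  ι (suc n) * (x ^ n * (y - x)) ⊕ x ^ suc n ≤ y ^ suc n
^-suc-increment-lower {x} {y} 0≤x x≤y zero = ℚₚ.≤-reflexive (solve 2
  (λ a b → (con 1ℚ :+ con 0ℚ) :* (con 1ℚ :* (b :- a)) :+ a :* con 1ℚ := b :* con 1ℚ) refl x y)
^-suc-increment-lower {x} {y} 0≤x x≤y (suc n) = begin
  (1ℚ ⊕ c) * (x * p * (y - x)) ⊕ x * (x * p)
    ≡⟨ solve 4 (λ x y p c → (con 1ℚ :+ c) :* (x :* p :* (y :- x)) :+ x :* (x :* p)
         := x :* (c :* (p :* (y :- x)) :+ x :* p) :+ x :* p :* (y :- x)) refl x y p c ⟩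
  x * (c * (p * (y - x)) ⊕ x * p) ⊕ x * p * (y - x)
    ≤⟨ ℚₚ.+-mono-≤ (*-monoˡ-≤ 0≤x (^-suc-increment-lower 0≤x x≤y n))
                   (*-monoʳ-≤ (p≤q⇒0≤q-p x≤y) (^-mono-≤ 0≤x x≤y (suc n))) ⟩
  x * (y * q) ⊕ y * q * (y - x)
    ≡⟨ solve 3 (λ x y q → x :* (y :* q) :+ y :* q :* (y :- x) := y :* (y :* q)) refl x y q ⟩
  y * (y * q) ∎
  where
  open ℚₚ.≤-Reasoning
  p = x ^ n
  q = y ^ n
  c = ι (suc n)

-- The same splitting of y^(n+2) - x^(n+2); here the outer factor x of the inductive term is
-- enlarged to y.
^-suc-increment-upper : ∀ {x y} → 0ℚ ≤ x → x ≤ y → ∀ n →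
  y ^ suc n ≤ ι (suc n) * (y ^ n * (y - x)) ⊕ x ^ suc n
^-suc-increment-upper {x} {y} 0≤x x≤y zero = ℚₚ.≤-reflexive (solve 2
  (λ a b → b :* con 1ℚ := (con 1ℚ :+ con 0ℚ) :* (con 1ℚ :* (b :- a)) :+ a :* con 1ℚ) refl x y)
^-suc-increment-upper {x} {y} 0≤x x≤y (suc n) = begin
  y * (y * q)
    ≡⟨ solve 3 (λ x y q → y :* (y :* q) := x :* (y :* q) :+ y :* q :* (y :- x)) refl x y q ⟩
  x * (y * q) ⊕ y * q * (y - x)
    ≤⟨ ℚₚ.+-monoˡ-≤ (y * q * (y - x)) (*-monoˡ-≤ 0≤x (^-suc-increment-upper 0≤x x≤y n)) ⟩
  x * (c * (q * (y - x)) ⊕ x * p) ⊕ y * q * (y - x)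
    ≤⟨ ℚₚ.+-monoˡ-≤ (y * q * (y - x)) (ℚₚ.≤-reflexive (solve 5
         (λ x y p q c → x :* (c :* (q :* (y :- x)) :+ x :* p)
           := x :* (c :* (q :* (y :- x))) :+ x :* (x :* p)) refl x y p q c)) ⟩
  x * (c * (q * (y - x))) ⊕ x * (x * p) ⊕ y * q * (y - x)
    ≤⟨ ℚₚ.+-monoˡ-≤ (y * q * (y - x)) (ℚₚ.+-monoˡ-≤ (x * (x * p)) (*-monoʳ-≤
         (0≤-* (0≤ι (suc n)) (0≤-* (0≤^ (ℚₚ.≤-trans 0≤x x≤y) n) (p≤q⇒0≤q-p x≤y))) x≤y)) ⟩
  y * (c * (q * (y - x))) ⊕ x * (x * p) ⊕ y * q * (y - x)
    ≡⟨ solve 5 (λ x y p q c → y :* (c :* (q :* (y :- x))) :+ x :* (x :* p) :+ y :* q :* (y :- x)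
         := (con 1ℚ :+ c) :* (y :* q :* (y :- x)) :+ x :* (x :* p)) refl x y p q c ⟩
  (1ℚ ⊕ c) * (y * q * (y - x)) ⊕ x * (x * p) ∎
  where
  open ℚₚ.≤-Reasoning
  p = x ^ n
  q = y ^ n
  c = ι (suc n)

-- Finite sums of rationals

sum-telescope-≤ : ∀ n (g F : ℕ → ℚ) → (∀ i → g i ⊕ F i ≤ F (suc i)) →
  sum {n} (g ∘ toℕ) ⊕ F 0 ≤ F n
sum-telescope-≤ zero    g F step = ℚₚ.≤-reflexive (ℚₚ.+-identityˡ (F 0))
sum-telescope-≤ (suc n) g F step = begin
  g 0 ⊕ s ⊕ F 0    ≡⟨ solve 3 (λ a b c → a :+ b :+ c := b :+ (a :+ c)) refl (g 0) s (F 0) ⟩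
  s ⊕ (g 0 ⊕ F 0)  ≤⟨ ℚₚ.+-monoʳ-≤ s (step 0) ⟩
  s ⊕ F 1          ≤⟨ sum-telescope-≤ n (g ∘ suc) (F ∘ suc) (step ∘ suc) ⟩
  F (suc n)        ∎
  where
  open ℚₚ.≤-Reasoning
  s = sum {n} (g ∘ suc ∘ toℕ)

sum-telescope-≥ : ∀ n (g F : ℕ → ℚ) → (∀ i → F (suc i) ≤ g i ⊕ F i) →
  F n ≤ sum {n} (g ∘ toℕ) ⊕ F 0
sum-telescope-≥ zero    g F step = ℚₚ.≤-reflexive (sym (ℚₚ.+-identityˡ (F 0)))
sum-telescope-≥ (suc n) g F step = begin
  F (suc n)        ≤⟨ sum-telescope-≥ n (g ∘ suc) (F ∘ suc) (step ∘ suc) ⟩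
  s ⊕ F 1          ≤⟨ ℚₚ.+-monoʳ-≤ s (step 0) ⟩
  s ⊕ (g 0 ⊕ F 0)  ≡⟨ solve 3 (λ a b c → b :+ (a :+ c) := a :+ b :+ c) refl (g 0) s (F 0) ⟩
  g 0 ⊕ s ⊕ F 0    ∎
  where
  open ℚₚ.≤-Reasoning
  s = sum {n} (g ∘ suc ∘ toℕ)

sum-snoc : ∀ n (g : ℕ → ℚ) → sum {suc n} (g ∘ toℕ) ≡ sum {n} (g ∘ toℕ) ⊕ g n
sum-snoc zero    g = ℚₚ.+-comm (g 0) 0ℚ
sum-snoc (suc n) g = trans (cong (g 0 ⊕_) (sum-snoc n (g ∘ suc)))
  (sym (ℚₚ.+-assoc (g 0) (sum {n} (g ∘ suc ∘ toℕ)) (g (suc n))))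

∣sum-*∣-bound : ∀ {n h} (a s : Vector ℚ n) → (∀ k → ∣ s k ∣ ≤ h) →
  ∣ sum (λ k → a k * s k) ∣ ≤ sum (λ k → ∣ a k ∣) * h
∣sum-*∣-bound {zero}  {h} a s s≤h = ℚₚ.≤-reflexive (sym (ℚₚ.*-zeroˡ h))
∣sum-*∣-bound {suc n} {h} a s s≤h = begin
  ∣ a₀ * s₀ ⊕ r ∣        ≤⟨ ℚₚ.∣p+q∣≤∣p∣+∣q∣ (a₀ * s₀) r ⟩
  ∣ a₀ * s₀ ∣ ⊕ ∣ r ∣    ≡⟨ cong (_⊕ ∣ r ∣) (ℚₚ.∣p*q∣≡∣p∣*∣q∣ a₀ s₀) ⟩
  ∣ a₀ ∣ * ∣ s₀ ∣ ⊕ ∣ r ∣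
    ≤⟨ ℚₚ.+-mono-≤ (*-monoˡ-≤ (ℚₚ.0≤∣p∣ a₀) (s≤h Fin.zero)) (∣sum-*∣-bound (a ∘ Fin.suc) (s ∘ Fin.suc) (s≤h ∘ Fin.suc)) ⟩
  ∣ a₀ ∣ * h ⊕ K * h     ≡⟨ sym (ℚₚ.*-distribʳ-+ h ∣ a₀ ∣ K) ⟩
  (∣ a₀ ∣ ⊕ K) * h       ∎
  where
  open ℚₚ.≤-Reasoning
  a₀ = a Fin.zero
  s₀ = s Fin.zero
  r  = sum (λ k → a (Fin.suc k) * s (Fin.suc k))
  K  = sum (λ k → ∣ a (Fin.suc k) ∣)

sum-*-- : ∀ {n} (a s t : Vector ℚ n) →
  sum (λ k → a k * s k) - sum (λ k → a k * t k) ≡ sum (λ k → a k * (s k - t k))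
sum-*-- {zero}  a s t = refl
sum-*-- {suc n} a s t = trans
  (solve 5 (λ x y z u v → (x :* y :+ u) :- (x :* z :+ v) := x :* (y :- z) :+ (u :- v)) refl
    (a Fin.zero) (s Fin.zero) (t Fin.zero) _ _)
  (cong (a Fin.zero * (s Fin.zero - t Fin.zero) ⊕_) (sum-*-- (a ∘ Fin.suc) (s ∘ Fin.suc) (t ∘ Fin.suc)))

-- The four summands match the expansion of a perturbed squared modulus: the old value, two cross
-- terms (real and imaginary), and the square of the perturbing monomial.
sum-linear : ∀ {n} α β γ (p q r t : Vector ℚ n) →
  sum (λ i → p i ⊕ (α * q i ⊕ (β * r i ⊕ γ * t i)))
    ≡ sum p ⊕ (α * sum q ⊕ (β * sum r ⊕ γ * sum t))
sum-linear {zero}  α β γ p q r t = solve 3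
  (λ a b c → con 0ℚ := con 0ℚ :+ (a :* con 0ℚ :+ (b :* con 0ℚ :+ c :* con 0ℚ))) refl α β γ
sum-linear {suc n} α β γ p q r t = trans
  (cong (p₀ ⊕ (α * q₀ ⊕ (β * r₀ ⊕ γ * t₀)) ⊕_)
    (sum-linear α β γ (p ∘ Fin.suc) (q ∘ Fin.suc) (r ∘ Fin.suc) (t ∘ Fin.suc)))
  (solve 11 (λ α β γ p q r t p′ q′ r′ t′ →
    p :+ (α :* q :+ (β :* r :+ γ :* t)) :+ (p′ :+ (α :* q′ :+ (β :* r′ :+ γ :* t′)))
    := p :+ p′ :+ (α :* (q :+ q′) :+ (β :* (r :+ r′) :+ γ :* (t :+ t′)))) refl
    α β γ p₀ q₀ r₀ t₀ (sum (p ∘ Fin.suc)) (sum (q ∘ Fin.suc)) (sum (r ∘ Fin.suc)) (sum (t ∘ Fin.suc)))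
  where
  p₀ = p Fin.zero
  q₀ = q Fin.zero
  r₀ = r Fin.zero
  t₀ = t Fin.zero

-- Riemann sums of monomials

-- The index `N` stands for `N + 1` cells, so that the mesh is `unitFraction N` and the right end is
-- `node N (suc N)`.
node : ℕ → ℕ → ℚ
node N i = ι i * unitFraction N

node-increment : ∀ N i → node N (suc i) - node N i ≡ unitFraction N
node-increment N i = solve 2 (λ a b → (con 1ℚ :+ a) :* b :- a :* b := b) refl (ι i) (unitFraction N)

0≤node : ∀ N i → 0ℚ ≤ node N i
0≤node N i = 0≤-* (0≤ι i) (ℚₚ.<⇒≤ (0<unitFraction N))

node-mono : ∀ N i → node N i ≤ node N (suc i)
node-mono N i = *-monoʳ-≤ (ℚₚ.<⇒≤ (0<unitFraction N))
  (0≤d⇒p≤p+d {ι i} {d = 1ℚ} (ℚₚ.<⇒≤ (ℚₚ.positive⁻¹ 1ℚ)) (ℚₚ.+-comm (ι i) 1ℚ))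

-- Left-endpoint Riemann sum of x^j on the uniform partition; the integral that it approximates is
-- `unitFraction j`.
monomialSum : ℕ → ℕ → ℚ
monomialSum N j = sum {suc N} (λ i → node N (toℕ i) ^ j * unitFraction N)

module _ (N j : ℕ) where
  private
    h = unitFraction N
    c = ι (suc j)
    x = node N
    g = λ i → x i ^ j * h

    S≡ : ∀ f → sum {suc N} (λ i → c * f (toℕ i)) ≡ c * sum {suc N} (f ∘ toℕ)
    S≡ f = sym (*-distribˡ-sum {suc N} c (f ∘ toℕ))

    x₀≡0 : x 0 ^ suc j ≡ 0ℚ
    x₀≡0 = trans (cong (_* x 0 ^ j) (ℚₚ.*-zeroˡ h)) (ℚₚ.*-zeroˡ (x 0 ^ j))

    xₙ≡1 : x (suc N) ^ suc j ≡ 1ℚ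
    xₙ≡1 = trans (cong (_^ suc j) (ι-suc*unitFraction N)) (1^n≡1 (suc j))

    c*unitFraction≡1 : 1ℚ ≡ c * unitFraction j
    c*unitFraction≡1 = sym (ι-suc*unitFraction j)

    cancel : ∀ {p q} → c * p ≤ c * q → p ≤ q
    cancel = ℚₚ.*-cancelˡ-≤-pos c {{positive (0<ι-suc j)}}

  -- After multiplication by j + 1, each left-endpoint term is at most the increment of x^(j+1) over
  -- its cell, and these increments telescope to 1.
  monomialSum-≤ : monomialSum N j ≤ unitFraction j
  monomialSum-≤ = cancel (begin
    c * monomialSum N j                     ≡⟨ S≡ g ⟨
    sum {suc N} (λ i → c * g (toℕ i))       ≡⟨ ℚₚ.+-identityʳ _ ⟨
    sum {suc N} (λ i → c * g (toℕ i)) ⊕ 0ℚ  ≡⟨ cong (sum {suc N} (λ i → c * g (toℕ i)) ⊕_) x₀≡0 ⟨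
    sum {suc N} (λ i → c * g (toℕ i)) ⊕ x 0 ^ suc j
      ≤⟨ sum-telescope-≤ (suc N) (λ i → c * g i) (λ i → x i ^ suc j) step ⟩
    x (suc N) ^ suc j                       ≡⟨ xₙ≡1 ⟩
    1ℚ                                      ≡⟨ c*unitFraction≡1 ⟩
    c * unitFraction j                      ∎)
    where
    open ℚₚ.≤-Reasoning
    step : ∀ i → c * g i ⊕ x i ^ suc j ≤ x (suc i) ^ suc j
    step i = subst (λ d → c * (x i ^ j * d) ⊕ x i ^ suc j ≤ x (suc i) ^ suc j)
      (node-increment N i) (^-suc-increment-lower (0≤node N i) (node-mono N i) j)

  -- The increments of x^(j+1) are bounded above by right-endpoint terms, so the right-endpoint sum
  -- dominates the integral. It exceeds the left-endpoint sum by at most one cell width.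
  monomialSum-≥ : unitFraction j ≤ monomialSum N j ⊕ h
  monomialSum-≥ = cancel (begin
    c * unitFraction j                             ≡⟨ c*unitFraction≡1 ⟨
    1ℚ                                             ≡⟨ xₙ≡1 ⟨
    x (suc N) ^ suc j
      ≤⟨ sum-telescope-≥ (suc N) (λ i → c * g (suc i)) (λ i → x i ^ suc j) step ⟩
    sum {suc N} (λ i → c * g (suc (toℕ i))) ⊕ x 0 ^ suc j
      ≡⟨ cong (sum {suc N} (λ i → c * g (suc (toℕ i))) ⊕_) x₀≡0 ⟩
    sum {suc N} (λ i → c * g (suc (toℕ i))) ⊕ 0ℚ   ≡⟨ ℚₚ.+-identityʳ _ ⟩
    sum {suc N} (λ i → c * g (suc (toℕ i)))        ≡⟨ S≡ (g ∘ suc) ⟩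
    c * sum {suc N} (λ i → g (suc (toℕ i)))        ≤⟨ *-monoˡ-≤ (0≤ι (suc j)) shift ⟩
    c * (monomialSum N j ⊕ h)                      ∎)
    where
    open ℚₚ.≤-Reasoning
    step : ∀ i → x (suc i) ^ suc j ≤ c * g (suc i) ⊕ x i ^ suc j
    step i = subst (λ d → x (suc i) ^ suc j ≤ c * (x (suc i) ^ j * d) ⊕ x i ^ suc j)
      (node-increment N i) (^-suc-increment-upper (0≤node N i) (node-mono N i) j)
    gₙ≡h : g (suc N) ≡ h
    gₙ≡h = trans (cong (λ y → y ^ j * h) (ι-suc*unitFraction N))
      (trans (cong (_* h) (1^n≡1 j)) (ℚₚ.*-identityˡ h))
    -- Passing from left to right endpoints drops the term at 0, which is nonnegative, and gains the
    -- term at 1, which is exactly `h`.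
    shift : sum {suc N} (λ i → g (suc (toℕ i))) ≤ monomialSum N j ⊕ h
    shift = 0≤d⇒p≤p+d (0≤-* (0≤^ (0≤node N 0) j) (ℚₚ.<⇒≤ (0<unitFraction N)))
      (trans (ℚₚ.+-comm _ (g 0)) (trans (sum-snoc (suc N) g) (cong (monomialSum N j ⊕_) gₙ≡h)))

  ∣monomialSum-unitFraction∣≤ : ∣ unitFraction j - monomialSum N j ∣ ≤ h
  ∣monomialSum-unitFraction∣≤ = begin
    ∣ unitFraction j - monomialSum N j ∣
      ≡⟨ ℚₚ.0≤p⇒∣p∣≡p (p≤q⇒0≤q-p monomialSum-≤) ⟩
    unitFraction j - monomialSum N j
      ≤⟨ ℚₚ.+-monoˡ-≤ (- monomialSum N j) monomialSum-≥ ⟩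
    monomialSum N j ⊕ h - monomialSum N j
      ≡⟨ solve 2 (λ a b → a :+ b :- a := b) refl (monomialSum N j) h ⟩
    h ∎
    where open ℚₚ.≤-Reasoning

unitFraction≤1 : ∀ n → unitFraction n ≤ 1ℚ
unitFraction≤1 n = subst (unitFraction n ≤_) (ι-suc*unitFraction n)
  (0≤d⇒p≤p+d (0≤-* (0≤ι n) (ℚₚ.<⇒≤ (0<unitFraction n)))
    (solve 2 (λ a b → b :+ a :* b := (con 1ℚ :+ a) :* b) refl (ι n) (unitFraction n)))

-- Real numbers, index by index

Eventually : (ℕ → Set) → Set
Eventually P = ∃ λ N → ∀ n → N ≤ℕ n → P n

always : ∀ {P : ℕ → Set} → (∀ n → P n) → Eventually P
always p = 0 , λ n _ → p n

infixl 5 _⊛_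

-- Applicative style: `always f ⊛ p ⊛ q` feeds finitely many eventual facts to a pointwise
-- implication, at the maximum of their thresholds.
_⊛_ : ∀ {P Q : ℕ → Set} → Eventually (λ n → P n → Q n) → Eventually P → Eventually Q
(M , f) ⊛ (N , p) = M ⊔ N , λ n n≥ →
  f n (ℕₚ.m⊔n≤o⇒m≤o M N n≥) (p n (ℕₚ.m⊔n≤o⇒n≤o M N n≥))

abstract
  eventuallyBounded : ∀ x → ∃ λ B → 0ℚ ≤ B × Eventually (λ ν → ∣ seq x ν ∣ ≤ B)
  eventuallyBounded x with cauchy x 1ℚ (ℚₚ.positive⁻¹ 1ℚ)
  ... | N , p = 1ℚ ⊕ ∣ seq x N ∣
    , 0≤-+ (ℚₚ.<⇒≤ (ℚₚ.positive⁻¹ 1ℚ)) (ℚₚ.0≤∣p∣ (seq x N))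
    , N , λ ν ν≥ → begin
      ∣ seq x ν ∣
        ≡⟨ cong ∣_∣ (solve 2 (λ a b → a := a :- b :+ b) refl (seq x ν) (seq x N)) ⟩
      ∣ seq x ν - seq x N ⊕ seq x N ∣      ≤⟨ ℚₚ.∣p+q∣≤∣p∣+∣q∣ (seq x ν - seq x N) (seq x N) ⟩
      ∣ seq x ν - seq x N ∣ ⊕ ∣ seq x N ∣
        ≤⟨ ℚₚ.+-monoˡ-≤ ∣ seq x N ∣ (ℚₚ.<⇒≤ (p ν N ν≥ ℕₚ.≤-refl)) ⟩
      1ℚ ⊕ ∣ seq x N ∣                     ∎
    where open ℚₚ.≤-Reasoning

  -- Supplies a bound, independent of the index `ν`, on the ℓ¹ norm of the rational approximations
  -- to the coefficients.
  eventuallyBounded-sum : ∀ n (x : ℕ → ℝ) → ∃ λ B → 0ℚ ≤ B ×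
    Eventually (λ ν → sum {n} (λ k → ∣ seq (x (toℕ k)) ν ∣) ≤ B)
  eventuallyBounded-sum zero    x = 0ℚ , ℚₚ.≤-refl , always (λ _ → ℚₚ.≤-refl)
  eventuallyBounded-sum (suc n) x =
    let B , 0≤B , x₀≤B = eventuallyBounded (x 0)
        C , 0≤C , x₊≤C = eventuallyBounded-sum n (x ∘ suc)
    in B ⊕ C , 0≤-+ 0≤B 0≤C , always (λ _ → ℚₚ.+-mono-≤) ⊛ x₀≤B ⊛ x₊≤C

-- Minimality compares norms, while the integrals give their squares; this passes from one to the
-- other.
square-mono-≤ℝ : ∀ {r s} → 0ℝ ≤ℝ r → r ≤ℝ s → r *ℝ r ≤ℝ s *ℝ s
square-mono-≤ℝ {r} {s} 0≤r r≤s ε 0<ε =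
  let B , 0≤B , r≤B = eventuallyBounded r
      C , 0≤C , s≤C = eventuallyBounded s
      0≤K = 0≤-+ (0≤-+ (0≤-* (ℚₚ.nonNegative⁻¹ 4ℚ) 0≤C) (0≤-* (ℚₚ.nonNegative⁻¹ 2ℚ) 0≤B))
              (ℚₚ.nonNegative⁻¹ 3ℚ)
      η , 0<η , η≤1 , Kη≤ε = smallMultiple 0≤K 0<ε
  in always (λ ν → square-mono-approx (seq r ν) (seq s ν) 0<η η≤1 Kη≤ε)
       ⊛ r≤B ⊛ s≤C ⊛ 0≤r η 0<η ⊛ r≤s η 0<η

fromℚ-mono-≤ : ∀ {p q} → p ≤ q → fromℚ p ≤ℝ fromℚ q
fromℚ-mono-≤ {p} p≤q ε 0<ε = always λ _ →
  subst (_< _) (ℚₚ.+-identityʳ p) (ℚₚ.+-mono-≤-< p≤q 0<ε)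

≈ℝ-pointwise : ∀ {x y} → (∀ ν → seq x ν ≡ seq y ν) → x ≈ℝ y
≈ℝ-pointwise {x} {y} x≡y ε 0<ε = always λ ν → subst (_< ε)
  (cong ∣_∣ (sym (trans (cong (_- seq y ν) (x≡y ν)) (ℚₚ.+-inverseʳ (seq y ν))))) 0<ε

≈ℝ-respˡ : ∀ {x y z} → (∀ ν → seq x ν ≡ seq y ν) → y ≈ℝ z → x ≈ℝ z
≈ℝ-respˡ {x} {y} {z} x≡y y≈z ε 0<ε =
  always (λ ν → subst (λ p → ∣ p - seq z ν ∣ < ε) (sym (x≡y ν))) ⊛ y≈z ε 0<ε

seq-sumℝ : ∀ {n} (f : Vector ℝ n) ν → seq (sumℝ f) ν ≡ sum (λ k → seq (f k) ν)
seq-sumℝ {zero}  f ν = refl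
seq-sumℝ {suc n} f ν = cong (seq (f Fin.zero) ν ⊕_) (seq-sumℝ (f ∘ Fin.suc) ν)

seq-re-sumℂ : ∀ {n} (f : Vector ℂ n) ν → seq (re (sumℂ f)) ν ≡ sum (λ k → seq (re (f k)) ν)
seq-re-sumℂ {zero}  f ν = refl
seq-re-sumℂ {suc n} f ν = cong (seq (re (f Fin.zero)) ν ⊕_) (seq-re-sumℂ (f ∘ Fin.suc) ν)

seq-im-sumℂ : ∀ {n} (f : Vector ℂ n) ν → seq (im (sumℂ f)) ν ≡ sum (λ k → seq (im (f k)) ν)
seq-im-sumℂ {zero}  f ν = refl
seq-im-sumℂ {suc n} f ν = cong (seq (im (f Fin.zero)) ν ⊕_) (seq-im-sumℂ (f ∘ Fin.suc) ν)

-- Coordinates of complex monomials and quotients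

module _ (x : ℝ) (ν : ℕ) where
  private y = seq x ν

  -- Both equalities are exact at every index, not merely up to `_≈ℝ_`, so complex monomials can be
  -- replaced by rational ones inside finite sums.
  fromℝ-^ : ∀ k → seq (re (fromℝ x ^ℂ k)) ν ≡ y ^ k × seq (im (fromℝ x ^ℂ k)) ν ≡ 0ℚ
  fromℝ-^ zero    = refl , refl
  fromℝ-^ (suc k) with fromℝ-^ k
  ... | re≡ , im≡ =
      trans (cong₂ (λ a b → y * a - 0ℚ * b) re≡ im≡)
        (solve 2 (λ y a → y :* a :- con 0ℚ :* con 0ℚ := y :* a) refl y (y ^ k))
    , trans (cong₂ (λ a b → y * b ⊕ 0ℚ * a) re≡ im≡)
        (solve 2 (λ y a → y :* con 0ℚ :+ con 0ℚ :* a := con 0ℚ) refl y (y ^ k))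

  module _ (z : ℂ) (k : ℕ) where
    re-monomial : seq (re (z *ℂ fromℝ x ^ℂ k)) ν ≡ seq (re z) ν * y ^ k
    re-monomial = trans
      (cong₂ (λ a b → seq (re z) ν * a - seq (im z) ν * b) (proj₁ (fromℝ-^ k)) (proj₂ (fromℝ-^ k)))
      (solve 3 (λ p q a → p :* a :- q :* con 0ℚ := p :* a) refl (seq (re z) ν) (seq (im z) ν) (y ^ k))

    im-monomial : seq (im (z *ℂ fromℝ x ^ℂ k)) ν ≡ seq (im z) ν * y ^ k
    im-monomial = trans
      (cong₂ (λ a b → seq (re z) ν * b ⊕ seq (im z) ν * a) (proj₁ (fromℝ-^ k)) (proj₂ (fromℝ-^ k)))
      (solve 3 (λ p q a → p :* con 0ℚ :+ q :* a := q :* a) refl (seq (re z) ν) (seq (im z) ν) (y ^ k))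

module _ (z : ℂ) (j ν : ℕ) where
  re-/ℕ : seq (re (z /ℕ suc j)) ν ≡ seq (re z) ν * unitFraction j
  re-/ℕ = solve 3 (λ p q u → p :* u :- q :* con 0ℚ := p :* u) refl
    (seq (re z) ν) (seq (im z) ν) (unitFraction j)

  im-/ℕ : seq (im (z /ℕ suc j)) ν ≡ seq (im z) ν * unitFraction j
  im-/ℕ = solve 3 (λ p q u → p :* con 0ℚ :+ q :* u := q :* u) refl
    (seq (re z) ν) (seq (im z) ν) (unitFraction j)

-- Polynomials and Riemann sums over uniform partitions

poly : (ℕ → ℚ) → ℕ → ℚ → ℚ
poly a n x = sum {n} (λ k → a (toℕ k) * x ^ toℕ k)

-- Discrete form of integrating a polynomial against x^m term by term: the sums over nodes and
-- coefficients are exchanged. Here `n` counts coefficients, so the degree is below `n`.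
poly-moment : ∀ a n m N →
  sum {suc N} (λ i → poly a n (node N (toℕ i)) * node N (toℕ i) ^ m * unitFraction N)
    ≡ sum {n} (λ k → a (toℕ k) * monomialSum N (m + toℕ k))
poly-moment a n m N = begin
  sum {suc N} (λ i → poly a n (x i) * x i ^ m * h)
    ≡⟨ sum-cong-≗ {suc N} (λ i → trans (ℚₚ.*-assoc (poly a n (x i)) (x i ^ m) h)
         (trans (*-distribʳ-sum {n} (x i ^ m * h) _) (sum-cong-≗ {n} (term i)))) ⟩
  sum {suc N} (λ i → sum {n} (λ k → a (toℕ k) * (x i ^ (m + toℕ k) * h)))
    ≡⟨ ∑-comm {suc N} {n} (λ i k → a (toℕ k) * (x i ^ (m + toℕ k) * h)) ⟩
  sum {n} (λ k → sum {suc N} (λ i → a (toℕ k) * (x i ^ (m + toℕ k) * h)))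
    ≡⟨ sum-cong-≗ {n} (λ k → sym (*-distribˡ-sum {suc N} (a (toℕ k)) (λ i → x i ^ (m + toℕ k) * h))) ⟩
  sum {n} (λ k → a (toℕ k) * monomialSum N (m + toℕ k)) ∎
  where
  open ≡-Reasoning
  h = unitFraction N
  x : Fin (suc N) → ℚ
  x i = node N (toℕ i)
  term : ∀ i (k : Fin n) →
    a (toℕ k) * x i ^ toℕ k * (x i ^ m * h) ≡ a (toℕ k) * (x i ^ (m + toℕ k) * h)
  term i k = trans
    (solve 4 (λ a p q h → a :* p :* (q :* h) := a :* (q :* p :* h)) refl
      (a (toℕ k)) (x i ^ toℕ k) (x i ^ m) h)
    (cong (λ y → a (toℕ k) * (y * h)) (sym (^-homo-* (x i) m (toℕ k))))

-- Tags are left endpoints, as in `monomialSum`. All points are constant rational sequences, so a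
-- Riemann sum read at index `ν` is a finite rational sum.
uniformPartition : ℕ → TaggedPartition
uniformPartition N = record
  { size  = suc N
  ; point = λ i → fromℚ (node N (toℕ i))
  ; tag   = λ i → fromℚ (node N (toℕ i))
  ; first = ≈ℝ-pointwise {fromℚ (node N 0)} {0ℝ} (λ _ → ℚₚ.*-zeroˡ (unitFraction N))
  ; last  = ≈ℝ-pointwise {fromℚ (node N (toℕ (fromℕ (suc N))))} {1ℝ} (λ _ →
      trans (cong (node N) (toℕ-fromℕ (suc N))) (ι-suc*unitFraction N))
  ; lower = λ i → fromℚ-mono-≤ (ℚₚ.≤-reflexive (cong (node N) (toℕ-inject₁ i)))
  ; upper = λ i → fromℚ-mono-≤ (node-mono N (toℕ i))
  }

open TaggedPartition using (width; riemannSum)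

module _ (N : ℕ) where
  private P = uniformPartition N

  seq-width : ∀ i ν → seq (width P i) ν ≡ unitFraction N
  seq-width i ν = trans (cong (λ j → node N (suc (toℕ i)) - node N j) (toℕ-inject₁ i))
    (node-increment N (toℕ i))

  width-≤ : ∀ {η} → unitFraction N ≤ η → ∀ i → width P i ≤ℝ fromℚ η
  width-≤ {η} h≤η i ε 0<ε =
    always (λ ν → subst (_< η ⊕ ε) (sym (seq-width i ν))) ⊛ fromℚ-mono-≤ h≤η ε 0<ε

  seq-riemannSum : ∀ f ν → seq (riemannSum P f) ν ≡
    sum {suc N} (λ i → seq (f (fromℚ (node N (toℕ i)))) ν * unitFraction N)
  seq-riemannSum f ν = trans
    (seq-sumℝ {suc N} (λ i → f (fromℚ (node N (toℕ i))) *ℝ width P i) ν)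
    (sum-cong-≗ {suc N} (λ i → cong (seq (f (fromℚ (node N (toℕ i)))) ν *_) (seq-width i ν)))

-- Each Riemann sum costs two `ε`, one from the integral and one from `_≤ℝ_`, and `I ≤ℝ J` costs the
-- fifth. The mesh bound `η` is chosen before `N`, and the threshold for `ν` may depend on `N`.
integral-comparison : ∀ {f g I J} → IsIntegral f I → IsIntegral g J → I ≤ℝ J →
  ∀ ε → 0ℚ < ε → ∃ λ η → 0ℚ < η × (∀ N → unitFraction N ≤ η → Eventually λ ν →
    seq (riemannSum (uniformPartition N) f) ν
      < seq (riemannSum (uniformPartition N) g) ν ⊕ (ε ⊕ ε ⊕ ε ⊕ ε ⊕ ε))
integral-comparison {f} {g} {I} {J} ∫f ∫g I≤J ε 0<ε =
  let η , 0<η , F = ∫f ε 0<ε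
      θ , 0<θ , G = ∫g ε 0<ε
  in η ⊓ θ , 0<p⊓q 0<η 0<θ , λ N h≤ →
     let P  = uniformPartition N
         F≤ = proj₁ (F P (width-≤ N (ℚₚ.≤-trans h≤ (ℚₚ.p⊓q≤p η θ))))
         ≤G = proj₂ (G P (width-≤ N (ℚₚ.≤-trans h≤ (ℚₚ.p⊓q≤q η θ))))
     in always (λ ν → chain {seq (riemannSum P f) ν} {seq I ν} {seq J ν} {seq (riemannSum P g) ν})
          ⊛ F≤ ε 0<ε ⊛ I≤J ε 0<ε ⊛ ≤G ε 0<ε
  where
  chain : ∀ {a b c d} → a < b ⊕ ε ⊕ ε → b < c ⊕ ε → c < d ⊕ ε ⊕ ε → a < d ⊕ (ε ⊕ ε ⊕ ε ⊕ ε ⊕ ε)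
  chain {a} {b} {c} {d} a<b b<c c<d = begin-strict
    a                          <⟨ a<b ⟩
    b ⊕ ε ⊕ ε                  <⟨ ℚₚ.+-monoˡ-< ε (ℚₚ.+-monoˡ-< ε b<c) ⟩
    c ⊕ ε ⊕ ε ⊕ ε              <⟨ ℚₚ.+-monoˡ-< ε (ℚₚ.+-monoˡ-< ε (ℚₚ.+-monoˡ-< ε c<d)) ⟩
    d ⊕ ε ⊕ ε ⊕ ε ⊕ ε ⊕ ε
      ≡⟨ solve 2 (λ d e → d :+ e :+ e :+ e :+ e :+ e := d :+ (e :+ e :+ e :+ e :+ e)) refl d ε ⟩
    d ⊕ (ε ⊕ ε ⊕ ε ⊕ ε ⊕ ε)    ∎
    where open ℚₚ.≤-Reasoning

-- Orthogonality of the minimizer to the last monomial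

module _ (c : ℕ → ℂ) (n : ℕ) where
  private
    m = suc n

    A B : ℕ → ℕ → ℚ
    A ν k = seq (re (c k)) ν
    B ν k = seq (im (c k)) ν

    -- f x = p_n(x) + d x^{n+1}, read off at every index of the approximating sequences.
    Extends : ℂ → (ℝ → ℂ) → Set
    Extends d f = ∀ x ν →
      seq (re (f x)) ν ≡ poly (A ν) m (seq x ν) ⊕ seq (re d) ν * seq x ν ^ m ×
      seq (im (f x)) ν ≡ poly (B ν) m (seq x ν) ⊕ seq (im d) ν * seq x ν ^ m

    extends : ∀ d → Extends d (λ x → partialSum c n x +ℂ d *ℂ fromℝ x ^ℂ m)
    extends d x ν =
        cong₂ _⊕_
          (trans (seq-re-sumℂ {m} terms ν)
            (sum-cong-≗ {m} (λ k → re-monomial x ν (c (toℕ k)) (toℕ k))))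
          (re-monomial x ν d m)
      , cong₂ _⊕_
          (trans (seq-im-sumℂ {m} terms ν)
            (sum-cong-≗ {m} (λ k → im-monomial x ν (c (toℕ k)) (toℕ k))))
          (im-monomial x ν d m)
      where
      terms : Vector ℂ m
      terms k = c (toℕ k) *ℂ fromℝ x ^ℂ toℕ k

    w : ℂ
    w = ∑≤ m (λ k → c k /ℕ (suc m + k))

    X Y : ℕ → ℚ
    X ν = seq (re w) ν
    Y ν = seq (im w) ν

    -- One coordinate of the inner product of p_m with x^m: exact when `s` is `unitFraction`, and
    -- its Riemann sum when `s` is `monomialSum N`.
    inner : (ℕ → ℚ) → (ℕ → ℚ) → ℚ
    inner a s = sum {suc m} (λ k → a (toℕ k) * s (m + toℕ k))

    quotients : Vector ℂ (suc m)
    quotients k = c (toℕ k) /ℕ (suc m + toℕ k)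

    X≡ : ∀ ν → X ν ≡ inner (A ν) unitFraction
    X≡ ν = trans (seq-re-sumℂ {suc m} quotients ν)
      (sum-cong-≗ {suc m} (λ k → re-/ℕ (c (toℕ k)) (m + toℕ k) ν))

    Y≡ : ∀ ν → Y ν ≡ inner (B ν) unitFraction
    Y≡ ν = trans (seq-im-sumℂ {suc m} quotients ν)
      (sum-cong-≗ {suc m} (λ k → im-/ℕ (c (toℕ k)) (m + toℕ k) ν))

    normSum : ℕ → (ℝ → ℂ) → ℕ → ℚ
    normSum N f ν = seq (riemannSum (uniformPartition N) (λ x → ∣ f x ∣²)) ν

    w-perturbed : ℂ
    w-perturbed = c m +ℂ -ℂ w

    -- The expansion of |p_m - w x^m|² holds at each node, hence exactly for Riemann sums; the cross
    -- terms become discrete inner products by `poly-moment`.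
    normSum-perturbed : ∀ {f g} → Extends (c m) f → Extends w-perturbed g →
      ∀ N ν → normSum N g ν ≡ normSum N f ν
      ⊕ (- (X ν ⊕ X ν) * inner (A ν) (monomialSum N)
      ⊕ (- (Y ν ⊕ Y ν) * inner (B ν) (monomialSum N)
      ⊕ (X ν * X ν ⊕ Y ν * Y ν) * monomialSum N (m + m)))
    normSum-perturbed {f} {g} ext-f ext-g N ν = begin
      normSum N g ν
        ≡⟨ seq-riemannSum N (λ x → ∣ g x ∣²) ν ⟩
      sum {suc N} (λ i → seq (∣ g (fromℚ (x i)) ∣²) ν * h)
        ≡⟨ sum-cong-≗ {suc N} expand ⟩
      sum {suc N} (λ i → F i ⊕ (α * q i ⊕ (β * r i ⊕ γ * t i)))
        ≡⟨ sum-linear {suc N} α β γ F q r t ⟩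
      sum {suc N} F ⊕ (α * sum {suc N} q ⊕ (β * sum {suc N} r ⊕ γ * sum {suc N} t))
        ≡⟨ cong₂ _⊕_ (sym (seq-riemannSum N (λ x → ∣ f x ∣²) ν))
             (cong₂ _⊕_ (cong (α *_) (poly-moment (A ν) (suc m) m N))
               (cong (λ s → β * s ⊕ γ * monomialSum N (m + m)) (poly-moment (B ν) (suc m) m N))) ⟩
      normSum N f ν ⊕ (α * inner (A ν) (monomialSum N)
        ⊕ (β * inner (B ν) (monomialSum N) ⊕ γ * monomialSum N (m + m))) ∎
      where
      open ≡-Reasoning
      h = unitFraction N
      α = - (X ν ⊕ X ν)
      β = - (Y ν ⊕ Y ν)
      γ = X ν * X ν ⊕ Y ν * Y ν
      x : Fin (suc N) → ℚ
      x i = node N (toℕ i)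
      F q r t : Fin (suc N) → ℚ
      F i = seq (∣ f (fromℚ (x i)) ∣²) ν * h
      q i = poly (A ν) (suc m) (x i) * x i ^ m * h
      r i = poly (B ν) (suc m) (x i) * x i ^ m * h
      t i = x i ^ (m + m) * h
      expand : ∀ i → seq (∣ g (fromℚ (x i)) ∣²) ν * h
        ≡ F i ⊕ (α * q i ⊕ (β * r i ⊕ γ * t i))
      expand i = begin
        seq (∣ g (fromℚ (x i)) ∣²) ν * h
          ≡⟨ cong₂ (λ u v → (u * u ⊕ v * v) * h)
               (proj₁ (ext-g (fromℚ (x i)) ν)) (proj₂ (ext-g (fromℚ (x i)) ν)) ⟩
        ((pA ⊕ (a - X ν) * y) * (pA ⊕ (a - X ν) * y)
          ⊕ (pB ⊕ (b - Y ν) * y) * (pB ⊕ (b - Y ν) * y)) * h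
          ≡⟨ solve 8 (λ p q a b X Y y h →
               ((p :+ (a :- X) :* y) :* (p :+ (a :- X) :* y)
                 :+ (q :+ (b :- Y) :* y) :* (q :+ (b :- Y) :* y)) :* h
               := ((p :+ a :* y) :* (p :+ a :* y) :+ (q :+ b :* y) :* (q :+ b :* y)) :* h
                 :+ (:- (X :+ X) :* ((p :+ a :* y) :* y :* h)
                 :+ (:- (Y :+ Y) :* ((q :+ b :* y) :* y :* h)
                 :+ (X :* X :+ Y :* Y) :* (y :* y :* h)))) refl pA pB a b (X ν) (Y ν) y h ⟩
        ((pA ⊕ a * y) * (pA ⊕ a * y) ⊕ (pB ⊕ b * y) * (pB ⊕ b * y)) * h
          ⊕ (α * ((pA ⊕ a * y) * y * h) ⊕ (β * ((pB ⊕ b * y) * y * h) ⊕ γ * (y * y * h)))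
          ≡⟨ cong₂ _⊕_
               (sym (cong₂ (λ u v → (u * u ⊕ v * v) * h)
                 (proj₁ (ext-f (fromℚ (x i)) ν)) (proj₂ (ext-f (fromℚ (x i)) ν))))
               -- `Extends` keeps the top coefficient apart; `sum-snoc` absorbs it, giving the
               -- polynomial with all `suc m` coefficients.
               (cong₂ _⊕_ (cong (λ p → α * (p * y * h)) (sym (sum-snoc m (λ k → A ν k * x i ^ k))))
                 (cong₂ _⊕_ (cong (λ p → β * (p * y * h)) (sym (sum-snoc m (λ k → B ν k * x i ^ k))))
                   (cong (λ p → γ * (p * h)) (sym (^-homo-* (x i) m m))))) ⟩
        F i ⊕ (α * q i ⊕ (β * r i ⊕ γ * t i)) ∎
        where
        y  = x i ^ m
        pA = poly (A ν) m (x i)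
        pB = poly (B ν) m (x i)
        a  = A ν m
        b  = B ν m

    -- Replacing one factor of z² by the Riemann sum `u` costs at most |z| |z - u|. With `K`
    -- bounding the ℓ¹ norm of the coefficients, |z| is at most K and |z - u| at most K times the
    -- mesh.
    inner-bounds : ∀ N {K} a z → z ≡ inner a unitFraction → sum {suc m} (λ k → ∣ a (toℕ k) ∣) ≤ K →
      z * z ≤ z * inner a (monomialSum N) ⊕ K * K * unitFraction N
    inner-bounds N {K} a z z≡ ∑≤K = begin
      z * z                       ≡⟨ solve 2 (λ z u → z :* z := z :* u :+ z :* (z :- u)) refl z u ⟩
      z * u ⊕ z * (z - u)         ≤⟨ ℚₚ.+-monoʳ-≤ (z * u) (p≤∣p∣ (z * (z - u))) ⟩
      z * u ⊕ ∣ z * (z - u) ∣     ≡⟨ cong (z * u ⊕_) (ℚₚ.∣p*q∣≡∣p∣*∣q∣ z (z - u)) ⟩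
      z * u ⊕ ∣ z ∣ * ∣ z - u ∣
        ≤⟨ ℚₚ.+-monoʳ-≤ (z * u) (ℚₚ.≤-trans (*-monoʳ-≤ (ℚₚ.0≤∣p∣ (z - u)) ∣z∣≤K) (*-monoˡ-≤ 0≤K ∣z-u∣≤Kh)) ⟩
      z * u ⊕ K * (K * h)         ≡⟨ cong (z * u ⊕_) (ℚₚ.*-assoc K K h) ⟨
      z * u ⊕ K * K * h           ∎
      where
      open ℚₚ.≤-Reasoning
      h = unitFraction N
      u = inner a (monomialSum N)
      bound : ∀ s {g} → 0ℚ ≤ g → (∀ j → ∣ s j ∣ ≤ g) → ∣ inner a s ∣ ≤ K * g
      bound s 0≤g s≤g = ℚₚ.≤-trans (∣sum-*∣-bound {suc m} (a ∘ toℕ) (λ k → s (m + toℕ k))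
        (λ k → s≤g (m + toℕ k))) (*-monoʳ-≤ 0≤g ∑≤K)
      ∣z∣≤K : ∣ z ∣ ≤ K
      ∣z∣≤K = subst₂ _≤_ (cong ∣_∣ (sym z≡)) (ℚₚ.*-identityʳ K)
        (bound unitFraction (ℚₚ.nonNegative⁻¹ 1ℚ) (λ j → subst (_≤ 1ℚ)
          (sym (ℚₚ.0≤p⇒∣p∣≡p (ℚₚ.<⇒≤ (0<unitFraction j)))) (unitFraction≤1 j)))
      0≤K : 0ℚ ≤ K
      0≤K = ℚₚ.≤-trans (ℚₚ.0≤∣p∣ z) ∣z∣≤K
      ∣z-u∣≤Kh : ∣ z - u ∣ ≤ K * h
      ∣z-u∣≤Kh = subst (_≤ K * h)
        (cong ∣_∣ (trans (sym (sum-*-- {suc m} (a ∘ toℕ)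
          (λ k → unitFraction (m + toℕ k)) (λ k → monomialSum N (m + toℕ k)))) (cong (_- u) (sym z≡))))
        (bound (λ j → unitFraction j - monomialSum N j) (ℚₚ.<⇒≤ (0<unitFraction N))
          (∣monomialSum-unitFraction∣≤ N))

    -- Substituting `R′` leaves 2XU + 2YV - (X² + Y²)S < 5ε. Since XU ≥ X² - η, YV ≥ Y² - η and S ≤
    -- 1, it follows that X² + Y² < 5ε + 4η ≤ 6ε. The ring identity collects these slacks.
    descent : ∀ {R R′ X Y U V S ε η} → R′ ≡ R ⊕ (- (X ⊕ X) * U ⊕ (- (Y ⊕ Y) * V ⊕ (X * X ⊕ Y * Y) * S)) →
      R < R′ ⊕ (ε ⊕ ε ⊕ ε ⊕ ε ⊕ ε) → S ≤ 1ℚ →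
      X * X ≤ X * U ⊕ η → Y * Y ≤ Y * V ⊕ η → η ⊕ η ⊕ η ⊕ η ≤ ε →
      X * X ⊕ Y * Y < ε ⊕ ε ⊕ ε ⊕ ε ⊕ ε ⊕ ε
    descent {R} {R′} {X} {Y} {U} {V} {S} {ε} {η} R′≡ R< S≤1 X²≤ Y²≤ η≤ = 0<d⇒p<p+d
      (ℚₚ.+-mono-<-≤ {0ℚ} {_} {0ℚ}
        (p<q⇒0<q-p (subst (λ p → R < p ⊕ (ε ⊕ ε ⊕ ε ⊕ ε ⊕ ε)) R′≡ R<))
        (0≤-+ (0≤-* (0≤-+ (0≤p² X) (0≤p² Y)) (p≤q⇒0≤q-p S≤1))
          (0≤-+ (p≤q⇒0≤q-p η≤)
            (0≤-+ (0≤-+ (p≤q⇒0≤q-p X²≤) (p≤q⇒0≤q-p X²≤)) (0≤-+ (p≤q⇒0≤q-p Y²≤) (p≤q⇒0≤q-p Y²≤))))))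
      (solve 8 (λ R X Y U V S ε η →
        X :* X :+ Y :* Y :+
          ((R :+ (:- (X :+ X) :* U :+ (:- (Y :+ Y) :* V :+ (X :* X :+ Y :* Y) :* S))
              :+ (ε :+ ε :+ ε :+ ε :+ ε) :- R)
          :+ ((X :* X :+ Y :* Y) :* (con 1ℚ :- S)
          :+ ((ε :- (η :+ η :+ η :+ η))
          :+ (((X :* U :+ η :- X :* X) :+ (X :* U :+ η :- X :* X))
            :+ ((Y :* V :+ η :- Y :* Y) :+ (Y :* V :+ η :- Y :* Y))))))
        := ε :+ ε :+ ε :+ ε :+ ε :+ ε) refl R X Y U V S ε η)

    norm-comparison : ∀ {f g} → ‖ f ‖≤‖ g ‖ → ∀ ε → 0ℚ < ε → ∃ λ η → 0ℚ < η ×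
      (∀ N → unitFraction N ≤ η → Eventually λ ν →
        normSum N f ν < normSum N g ν ⊕ (ε ⊕ ε ⊕ ε ⊕ ε ⊕ ε))
    norm-comparison {f} {g} (r , s , (0≤r , ∫r) , (_ , ∫s) , r≤s) =
      integral-comparison {λ x → ∣ f x ∣²} {λ x → ∣ g x ∣²} {r *ℝ r} {s *ℝ s}
        ∫r ∫s (square-mono-≤ℝ {r} {s} 0≤r r≤s)

    w-small-at : ∀ {f g K L ε} → Extends (c m) f → Extends w-perturbed g → ∀ N → 0ℚ ≤ K → 0ℚ ≤ L →
      4ℚ * ((K ⊕ L) * (K ⊕ L)) * unitFraction N ≤ ε → ∀ ν →
      normSum N f ν < normSum N g ν ⊕ (ε ⊕ ε ⊕ ε ⊕ ε ⊕ ε) →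
      sum {suc m} (λ k → ∣ A ν (toℕ k) ∣) ≤ K → sum {suc m} (λ k → ∣ B ν (toℕ k) ∣) ≤ L →
      X ν * X ν ⊕ Y ν * Y ν < ε ⊕ ε ⊕ ε ⊕ ε ⊕ ε ⊕ ε
    w-small-at {f} {g} {K} {L} {ε} ext-f ext-g N 0≤K 0≤L 4Dh≤ε ν Rf<Rg ∑A≤K ∑B≤L =
      descent {normSum N f ν} {normSum N g ν} {X ν} {Y ν}
        {inner (A ν) (monomialSum N)} {inner (B ν) (monomialSum N)} {monomialSum N (m + m)}
        (normSum-perturbed {f} {g} ext-f ext-g N ν) Rf<Rg
        (ℚₚ.≤-trans (monomialSum-≤ N (m + m)) (unitFraction≤1 (m + m)))
        -- `K ⊕ L` serves as a common coefficient bound for both coordinates, so that `descent`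
        -- receives a single error (K + L)² h.
        (inner-bounds N (A ν) (X ν) (X≡ ν) (ℚₚ.≤-trans ∑A≤K (0≤d⇒p≤p+d 0≤L refl)))
        (inner-bounds N (B ν) (Y ν) (Y≡ ν) (ℚₚ.≤-trans ∑B≤L (0≤d⇒p≤p+d 0≤K (ℚₚ.+-comm L K))))
        (subst (_≤ ε) (fourfold ((K ⊕ L) * (K ⊕ L)) (unitFraction N)) 4Dh≤ε)
      where
      fourfold : ∀ d h → 4ℚ * d * h ≡ d * h ⊕ d * h ⊕ d * h ⊕ d * h
      fourfold = solve 2 (λ d h → con 4ℚ :* d :* h := d :* h :+ d :* h :+ d :* h :+ d :* h) refl

    -- Order of choices: the coefficient bounds and the mesh bound `η` come first, then one `N` fine
    -- enough for both errors, and only then a large index `ν`.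
    w-small : ∀ {f g} → Extends (c m) f → Extends w-perturbed g → ‖ f ‖≤‖ g ‖ → ∀ ε → 0ℚ < ε →
      Eventually λ ν → X ν * X ν ⊕ Y ν * Y ν < ε ⊕ ε ⊕ ε ⊕ ε ⊕ ε ⊕ ε
    w-small {f} {g} ext-f ext-g f≤g ε 0<ε =
      let K , 0≤K , A≤K = eventuallyBounded-sum (suc m) (re ∘ c)
          L , 0≤L , B≤L = eventuallyBounded-sum (suc m) (im ∘ c)
          η , 0<η , compare = norm-comparison {f} {g} f≤g ε 0<ε
          N , h≤η , 4Dh≤ε = fineMesh (0≤-* (ℚₚ.nonNegative⁻¹ 4ℚ) (0≤p² (K ⊕ L))) 0<η 0<ε
      in always (w-small-at {f} {g} ext-f ext-g N 0≤K 0≤L 4Dh≤ε) ⊛ compare N h≤η ⊛ A≤K ⊛ B≤L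

  minimizer-orthogonal : IsMinimizer c n (c (suc n)) →
    ∑≤ (suc n) (λ k → c k /ℕ (suc (suc n) + k)) ≈ℂ 0ℂ
  minimizer-orthogonal minimal =
      (λ ε 0<ε → always (λ ν → component {ε} {Y ν} {X ν} 0<ε) ⊛ small (0<ε²/6 0<ε))
    , (λ ε 0<ε → always (λ ν q → component {ε} {X ν} {Y ν} 0<ε (subst (_< _) (ℚₚ.+-comm (X ν * X ν) (Y ν * Y ν)) q))
        ⊛ small (0<ε²/6 0<ε))
    where
    small : ∀ {ε} → 0ℚ < ε → Eventually λ ν → X ν * X ν ⊕ Y ν * Y ν < ε ⊕ ε ⊕ ε ⊕ ε ⊕ ε ⊕ ε
    small {ε} = w-small
      {λ x → partialSum c n x +ℂ c m *ℂ fromℝ x ^ℂ m}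
      {λ x → partialSum c n x +ℂ w-perturbed *ℂ fromℝ x ^ℂ m}
      (extends (c m)) (extends w-perturbed) (minimal w-perturbed) ε
    -- `unitFraction 5` is 1/6, so the six copies of the tolerance in `small` add up to ε² and each
    -- coordinate of w is below ε.
    sixth : ℚ → ℚ
    sixth ε = ε * ε * unitFraction 5
    0<ε²/6 : ∀ {ε} → 0ℚ < ε → 0ℚ < sixth ε
    0<ε²/6 0<ε = 0<-* (0<-* 0<ε 0<ε) (0<unitFraction 5)
    component : ∀ {ε y x} → 0ℚ < ε →
      x * x ⊕ y * y < sixth ε ⊕ sixth ε ⊕ sixth ε ⊕ sixth ε ⊕ sixth ε ⊕ sixth ε → ∣ x - 0ℚ ∣ < ε
    component {ε} {y} {x} 0<ε x²+y²< = subst (λ p → ∣ p ∣ < ε) (sym (ℚₚ.+-identityʳ x))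
      (p²<q²⇒∣p∣<q 0<ε (ℚₚ.≤-<-trans (0≤d⇒p≤p+d (0≤p² y) refl)
        (subst (x * x ⊕ y * y <_) (solve 1 (λ e → let s = e :* e :* con (unitFraction 5) in
          s :+ s :+ s :+ s :+ s :+ s := e :* e) refl ε) x²+y²<)))

proposition1 : (c : ℕ → ℂ) → IsOrthorecursive c →
    ∀ n → ∑≤ n (λ k → c k /ℕ (suc n + k)) ≈ℂ δ n 0
-- The sum is the single term c_0 / 1, whose coordinates equal those of `c 0` at every index.
proposition1 c ((re≈1 , im≈0) , _) zero =
    ≈ℝ-respˡ {re w} {re (c 0)} {1ℝ} re≡ re≈1
  , ≈ℝ-respˡ {im w} {im (c 0)} {0ℝ} im≡ im≈0
  where
  w : ℂ
  w = ∑≤ 0 (λ k → c k /ℕ (1 + k))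
  re≡ : ∀ ν → seq (re w) ν ≡ seq (re (c 0)) ν
  re≡ ν = trans (ℚₚ.+-identityʳ (seq (re (c 0 /ℕ 1)) ν))
    (trans (re-/ℕ (c 0) 0 ν) (ℚₚ.*-identityʳ (seq (re (c 0)) ν)))
  im≡ : ∀ ν → seq (im w) ν ≡ seq (im (c 0)) ν
  im≡ ν = trans (ℚₚ.+-identityʳ (seq (im (c 0 /ℕ 1)) ν))
    (trans (im-/ℕ (c 0) 0 ν) (ℚₚ.*-identityʳ (seq (im (c 0)) ν)))
-- `δ (suc n) 0` computes to `0ℂ`, so orthogonality of p_(n+1) to x^(n+1) is the claim itself.
proposition1 c (_ , minimal) (suc n) = minimizer-orthogonal c n (proj₁ (minimal n))
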